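{- For every connected bipartite graph $G$, $\chi_{\rm cg}(G)\le 2$, where $\chi_{\rm cg}(G)$ denotes the connected game chromatic number of $G$.
   Context: All graphs are finite, nonempty, undirected, simple and have no loops. Connected graph coloring game: given a connected graph $G$ and a set of $k$ colors, two players, Alice and Bob, alternate turns, Alice having the first move. Initially all vertices are uncolored. On their turn, the player chooses an uncolored vertex of $G$ and assigns to it one of the $k$ colors, different from the colors of all its already colored neighbors (the coloring must be proper). Moreover, except for Alice's very first move (for which she may choose any vertex), the chosen vertex must have at least one already colored neighbor; equivalently, after each turn the subgraph induced by the set of colored vertices is connected. The game stops when no legal move is available. Alice wins if and only if all the vertices of $G$ are eventually colored; otherwise Bob wins. (Equivalently, Bob wins if and only if, at some step of the game, all the $k$ colors appear in the neighborhood of some uncolored vertex.) The connected game chromatic number $\chi_{\rm cg}(G)$ of a connected graph $G$ is the smallest integer $k$ for which Alice has a winning strategy when playing the connected graph coloring game on $G$ with $k$ colors. -}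

module Defs where

open import Data.Bool.Base using (Bool)
open import Data.Fin.Base using (Fin)
open import Data.Maybe.Base using (Maybe; just; nothing)
open import Data.Nat.Base using (ℕ; _≤_; NonZero)
open import Data.Product.Base using (_×_; Σ-syntax; ∃-syntax; ∃₂)
open import Data.Sum.Base using (_⊎_)
open import Data.Vec.Functional using (Vector; replicate; updateAt)
open import Function.Base using (const)
open import Level using (0ℓ)
open import Relation.Binary.Construct.Closure.ReflexiveTransitive using (Star)
open import Relation.Binary.Core using (Rel)
open import Relation.Binary.Definitions using (Decidable; Irreflexive; Symmetric)
open import Relation.Binary.PropositionalEquality.Core using (_≡_; _≢_)

record Graph : Set₁ where
  field
    order    : ℕ
    nonEmpty : NonZero order
    Adj      : Rel (Fin order) 0ℓ
    adj?     : Decidable Adj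
    symm     : Symmetric Adj
    irrefl   : Irreflexive _≡_ Adj

  Vertex : Set
  Vertex = Fin order

Connected : Graph → Set
Connected G = ∀ u v → Star Adj u v
  where open Graph G

Bipartite : Graph → Set
Bipartite G =
  Σ[ side ∈ (Vertex → Bool) ] (∀ {u v} → Adj u v → side u ≢ side v)
  where open Graph G

module ConnectedColouringGame (G : Graph) (k : ℕ) where
  open Graph G

  Colour : Set
  Colour = Fin k

  Position : Set
  Position = Vector (Maybe Colour) order

  initial : Position
  initial = replicate order nothing

  Coloured : Position → Vertex → Set
  Coloured c v = ∃[ a ] c v ≡ just a

  Complete : Position → Set
  Complete c = ∀ v → Coloured c v

  -- No vertex is coloured yet.  As colours are never removed, this holds
  -- only before the very first move.
  Blank : Position → Set
  Blank c = ∀ v → c v ≡ nothing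

  record Legal (c : Position) (v : Vertex) (a : Colour) : Set where
    field
      uncoloured : c v ≡ nothing
      proper     : ∀ u → Adj v u → c u ≢ just a
      connected  : Blank c ⊎ (∃[ u ] Adj v u × Coloured c u)

  play : Position → Vertex → Colour → Position
  play c v a = updateAt c v (const (just a))

  -- Winning strategies for Alice, as well-founded strategy trees: she picks
  -- one legal move at her turns and answers every legal move of Bob.  If no
  -- legal move is available, then only `finished` can apply, so Alice wins a
  -- stopped game exactly when all vertices are coloured.
  mutual
    data AliceToMove (c : Position) : Set where
      finished : Complete c → AliceToMove c
      choose   : ∀ v a → Legal c v a → BobToMove (play c v a) → AliceToMove c

    data BobToMove (c : Position) : Set where
      finished : Complete c → BobToMove c
      answer   : ∃₂ (Legal c) →
                 (∀ v a → Legal c v a → AliceToMove (play c v a)) →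
                 BobToMove c

AliceWins : Graph → ℕ → Set
AliceWins G k = AliceToMove initial
  where open ConnectedColouringGame G k

-- χcg as a relation: k is the least number of colours with which Alice has a
-- winning strategy.  Such a k is unique.
IsConnectedGameChromaticNumber : Graph → ℕ → Set
IsConnectedGameChromaticNumber G k =
  AliceWins G k × (∀ j → AliceWins G j → k ≤ j)

{-# OPTIONS --safe #-}
-- With two colours, the connectivity rule leaves no freedom: every move after
-- the first takes place next to a coloured vertex, so its colour is the one
-- prescribed by the proper 2-colouring that agrees with the first move.  Hence
-- the colouring never gets stuck, and whatever is played, Alice wins.
module Submission where

open import Defs
open import Data.Fin.Base using (Fin; zero; suc; punchIn)
open import Data.Fin.Properties using (_≟_; any?; punchInᵢ≢i; 2↔Bool)
open import Data.Fin.Subset using (Subset; _∈_; _⊂_; _-_; ⊤)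
open import Data.Fin.Subset.Induction using (⊂-wellFounded)
open import Data.Fin.Subset.Properties using (∈⊤; x∈p⇒p-x⊂p; x∈p∧x≢y⇒x∈p-y)
open import Data.Maybe.Base using (just; nothing)
open import Data.Maybe.Properties using (≡-dec; just-injective)
open import Data.Nat.Base using (ℕ; _≤_; zero; suc; z≤n; s≤s)
open import Data.Nat.Properties using (≤-refl)
open import Data.Product.Base using (_×_; _,_; ∃; ∃-syntax; ∃₂)
open import Data.Sum.Base using (inj₁; inj₂)
open import Data.Vec.Functional.Properties using (updateAt-updates; updateAt-minimal)
open import Function.Base using (_∘_)
open import Function.Bundles using (Inverse; module Injection)
open import Function.Properties.Inverse using (↔-sym; Inverse⇒Injection)
open import Induction.WellFounded using (Acc; acc)
open import Relation.Binary.Construct.Closure.ReflexiveTransitive using (Star; ε; _◅_)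
open import Relation.Binary.PropositionalEquality
  using (_≡_; _≢_; refl; sym; trans; cong)
open import Relation.Nullary using (¬_; Dec; yes; no; contradiction)

-- With two colours, avoiding one leaves a single choice; this is what makes moves forced.
≢-≢⇒≡ : {a b c : Fin 2} → a ≢ b → c ≢ b → a ≡ c
≢-≢⇒≡ {zero}     {_}        {zero}     _   _   = refl
≢-≢⇒≡ {suc zero} {_}        {suc zero} _   _   = refl
≢-≢⇒≡ {zero}     {zero}     {suc zero} a≢b _   = contradiction refl a≢b
≢-≢⇒≡ {zero}     {suc zero} {suc zero} _   c≢b = contradiction refl c≢b
≢-≢⇒≡ {suc zero} {zero}     {zero}     _   c≢b = contradiction refl c≢b
≢-≢⇒≡ {suc zero} {suc zero} {zero}     a≢b _   = contradiction refl a≢b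

module _ (G : Graph) (k : ℕ) where
  open Graph G
  open ConnectedColouringGame G k

  uncoloured? : (c : Position) (v : Vertex) → Dec (c v ≡ nothing)
  uncoloured? c v = ≡-dec _≟_ (c v) nothing

  ¬uncoloured⇒coloured : ∀ {c : Position} {v} → c v ≢ nothing → Coloured c v
  ¬uncoloured⇒coloured {c} {v} cv≢nothing with c v
  ... | just a  = a , refl
  ... | nothing = contradiction refl cv≢nothing

  coloured⇒¬uncoloured : ∀ {c v} → Coloured c v → c v ≢ nothing
  coloured⇒¬uncoloured (_ , cv≡just) cv≡nothing with () ← trans (sym cv≡just) cv≡nothing

  play-coloured : ∀ c v a → Coloured (play c v a) v
  play-coloured c v a = a , updateAt-updates v c

  -- Walking along the path, the first step onto an uncoloured vertex is the edge sought.
  frontierEdge : ∀ (c : Position) {u v} → Star Adj u v → Coloured c u → c v ≡ nothing →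
                 ∃₂ λ x y → Adj x y × Coloured c x × c y ≡ nothing
  frontierEdge c ε u-coloured v-uncoloured =
    contradiction v-uncoloured (coloured⇒¬uncoloured {c} u-coloured)
  frontierEdge c (_◅_ {j = w} uw path) u-coloured v-uncoloured with uncoloured? c w
  ... | yes w-uncoloured = _ , w , uw , u-coloured , w-uncoloured
  ... | no  w-coloured   =
    frontierEdge c path (¬uncoloured⇒coloured {c} w-coloured) v-uncoloured

module _ (G : Graph) (conn : Connected G) where
  open Graph G
  open ConnectedColouringGame G 2

  module _ (f : Vertex → Colour) (f-proper : ∀ {u v} → Adj u v → f u ≢ f v) where

    Agrees : Position → Set
    Agrees c = ∀ {v a} → c v ≡ just a → a ≡ f v

    -- An invariant of play after the first move. `started` excludes the blank case of the
    -- connectivity rule, and `U`, an upper bound for the set of uncoloured vertices, is the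
    -- termination measure.
    record Reachable (c : Position) (U : Subset order) : Set where
      field
        started     : ∃ (Coloured c)
        agrees      : Agrees c
        uncoloured⊆ : ∀ {v} → c v ≡ nothing → v ∈ U

    -- `started` is not among the hypotheses, so that Alice's first move is covered along with all
    -- later ones.
    play-reachable : ∀ {c U v} → Agrees c → (∀ {u} → c u ≡ nothing → u ∈ U) →
                     Reachable (play c v (f v)) (U - v)
    play-reachable {c} {U} {v} agrees uncoloured⊆ = record
      { started     = v , play-coloured G 2 c v (f v)
      ; agrees      = agrees′
      ; uncoloured⊆ = uncoloured⊆′
      }
      where
      agrees′ : Agrees (play c v (f v))
      agrees′ {u} eq with u ≟ v
      ... | yes refl = just-injective (trans (sym eq) (updateAt-updates v c))
      ... | no  u≢v  = agrees (trans (sym (updateAt-minimal u v c u≢v)) eq)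

      uncoloured⊆′ : ∀ {u} → play c v (f v) u ≡ nothing → u ∈ U - v
      uncoloured⊆′ {u} eq with u ≟ v
      ... | yes refl = contradiction eq
        (coloured⇒¬uncoloured G 2 {play c v (f v)} (play-coloured G 2 c v (f v)))
      ... | no  u≢v  = x∈p∧x≢y⇒x∈p-y
        (uncoloured⊆ (trans (sym (updateAt-minimal u v c u≢v)) eq)) u≢v

    module _ {c U} (r : Reachable c U) where
      open Reachable r

      -- A coloured neighbour `u` of `v` carries `f u`; both `a` and `f v` differ from it.
      forced : ∀ {v a} → Legal c v a → a ≡ f v
      forced record { connected = inj₁ blank } with v , v-coloured ← started =
        contradiction (blank v) (coloured⇒¬uncoloured G 2 {c} v-coloured)
      forced record { proper = proper ; connected = inj₂ (u , vu , b , cu≡b) } =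
        ≢-≢⇒≡ (λ { refl → proper u vu (trans cu≡b (cong just (agrees cu≡b))) })
              (f-proper vu)

      -- The vertex `w` may be far from the coloured part, so the move is made at the uncoloured end
      -- of a frontier edge. Its coloured neighbours carry their `f`-values, hence `f` is proper
      -- there.
      legalMove : ∀ {w} → c w ≡ nothing → ∃[ v ] Legal c v (f v)
      legalMove {w} w-uncoloured
        with u , u-coloured ← started
        with x , y , xy , x-coloured , y-uncoloured
               ← frontierEdge G 2 c (conn u w) u-coloured w-uncoloured
        = y , record
          { uncoloured = y-uncoloured
          ; proper     = λ z yz cz≡fy → f-proper yz (agrees cz≡fy)
          ; connected  = inj₂ (x , symm xy , x-coloured)
          }

      complete : ¬ (∃[ w ] c w ≡ nothing) → Complete c
      complete none v = ¬uncoloured⇒coloured G 2 {c} (λ eq → none (v , eq))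

      afterMove : ∀ {v a} → Legal c v a → Reachable (play c v a) (U - v)
      afterMove l with refl ← forced l = play-reachable agrees uncoloured⊆

      shrinks : ∀ {v a} → Legal c v a → U - v ⊂ U
      shrinks l = x∈p⇒p-x⊂p (uncoloured⊆ (Legal.uncoloured l))

    mutual
      -- Well-founded induction on `U`, shared by both players: an incomplete position always has a
      -- legal move, and every legal move, whoever makes it, preserves the invariant and shrinks
      -- `U`.
      reachable⇒aliceToMove : ∀ {c U} → Acc _⊂_ U → Reachable c U → AliceToMove c
      reachable⇒aliceToMove {c} (acc rec) r with any? (uncoloured? G 2 c)
      ... | no  none    = finished (complete r none)
      ... | yes (_ , w) with v , l ← legalMove r w =
        choose v (f v) l (reachable⇒bobToMove (rec (shrinks r l)) (afterMove r l))

      reachable⇒bobToMove : ∀ {c U} → Acc _⊂_ U → Reachable c U → BobToMove c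
      reachable⇒bobToMove {c} (acc rec) r with any? (uncoloured? G 2 c)
      ... | no  none    = finished (complete r none)
      ... | yes (_ , w) with v , l ← legalMove r w =
        answer (v , f v , l)
               (λ u a m → reachable⇒aliceToMove (rec (shrinks r m)) (afterMove r m))

    aliceWinsFrom : Vertex → AliceWins G 2
    aliceWinsFrom v = choose v (f v) firstMove
      -- On the blank position agreement with `f` is vacuous and `⊤` bounds the uncoloured set.
      (reachable⇒bobToMove (⊂-wellFounded (⊤ - v)) (play-reachable (λ ()) (λ _ → ∈⊤)))
      where
      firstMove : Legal initial v (f v)
      firstMove = record
        { uncoloured = refl
        ; proper     = λ _ _ ()
        ; connected  = inj₁ (λ _ → refl)
        }

bipartite⇒aliceWins : (G : Graph) → Connected G → Bipartite G →
                      Graph.Vertex G → AliceWins G 2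
bipartite⇒aliceWins G conn (side , side-proper) =
  aliceWinsFrom G conn (from ∘ side) (λ uv → side-proper uv ∘ from-injective)
  where
  open Inverse 2↔Bool using (from)
  from-injective = Injection.injective (Inverse⇒Injection (↔-sym 2↔Bool))

-- Without colours, the given vertex can never be coloured and Alice has no move to choose.
aliceWins⇒1≤ : (G : Graph) → Graph.Vertex G → ∀ k → AliceWins G k → 1 ≤ k
aliceWins⇒1≤ G v (suc k) _ = s≤s z≤n
aliceWins⇒1≤ G v zero (ConnectedColouringGame.finished complete) with () ← complete v
aliceWins⇒1≤ G v zero (ConnectedColouringGame.choose _ () _ _)

-- With one colour, Bob has no legal answer to Alice's first move.
aliceWins⇒2≤ : (G : Graph) → (∀ v → ∃[ w ] w ≢ v) → Graph.Vertex G →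
               ∀ k → AliceWins G k → 2 ≤ k
aliceWins⇒2≤ G other v₀ (suc (suc k)) _ = s≤s (s≤s z≤n)
aliceWins⇒2≤ G other v₀ zero win with () ← aliceWins⇒1≤ G v₀ zero win
aliceWins⇒2≤ G other v₀ (suc zero) (ConnectedColouringGame.finished complete)
  with () ← complete v₀
aliceWins⇒2≤ G other v₀ (suc zero)
  (ConnectedColouringGame.choose v zero _ (ConnectedColouringGame.finished complete))
  with w , w≢v ← other v
  with a , eq ← complete w
  with () ← trans (sym (updateAt-minimal w v _ w≢v)) eq
aliceWins⇒2≤ G other v₀ (suc zero)
  (ConnectedColouringGame.choose v zero _ (ConnectedColouringGame.answer (_ , zero , l) _))
  with ConnectedColouringGame.Legal.connected l
... | inj₂ (u , wu , zero , eq) =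
  contradiction eq (ConnectedColouringGame.Legal.proper l u wu)
... | inj₁ blank with () ← trans (sym (updateAt-updates v _)) (blank v)

theorem3 : (G : Graph) → Connected G → Bipartite G →
    ∃[ k ] (IsConnectedGameChromaticNumber G k × k ≤ 2)
theorem3 record { order = zero ; nonEmpty = record { nonZero = () } }
-- On a single vertex the first move completes the colouring, so the exact value is 1.
theorem3 G@record { order = suc zero } _ _ =
  1 , (choose zero zero firstMove (finished (λ { zero → zero , refl }))
      , aliceWins⇒1≤ G zero) , s≤s z≤n
  where
  open ConnectedColouringGame G 1
  firstMove : Legal initial zero zero
  firstMove = record
    { uncoloured = refl
    ; proper     = λ _ _ ()
    ; connected  = inj₁ (λ _ → refl)
    }
-- From two vertices on the exact value is 2; `punchIn v zero` supplies a vertex other than `v` for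
-- the lower bound.
theorem3 G@record { order = suc (suc _) } conn bip =
  2 , ( bipartite⇒aliceWins G conn bip zero
      , aliceWins⇒2≤ G (λ v → punchIn v zero , punchInᵢ≢i v zero) zero) , ≤-refl
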